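{- Let $\gamma \geq 0$ be an integer and $\mathcal{P}$ be a $\gamma$-pluriassociative algebra admitting a $b$-wire-unit $e$ for some $b \in [\gamma]$. Then (i) for all $a \in [b]$, the operations $\dashv_a$, $\dashv_b$, $\vdash_a$, and $\vdash_b$ of $\mathcal{P}$ are equal; (ii) $e$ is also an $a$-wire-unit for all $a \in [b]$; (iii) $e$ is the only wire-unit of $\mathcal{P}$; (iv) if $e'$ is an $a$-bar-unit for some $a \in [b]$, then $e' = e$.
   Context: The ground field has characteristic zero; $[n]=\{1,\dots,n\}$. A $\gamma$-pluriassociative algebra is a vector space with bilinear operations $\dashv_a, \vdash_a$, $a \in [\gamma]$, such that for all elements $x,y,z$ and all $a, a' \in [\gamma]$, with $a \uparrow a' := \max(a,a')$: $(x \vdash_{a'} y) \dashv_a z = x \vdash_{a'} (y \dashv_a z)$; $(x \dashv_{a\uparrow a'} y) \dashv_a z = x \dashv_a (y \vdash_{a'} z)$; $(x \dashv_{a'} y) \vdash_a z = x \vdash_a (y \vdash_{a \uparrow a'} z)$; $(x \dashv_a y) \dashv_{a\uparrow a'} z = x \dashv_a (y \dashv_{a'} z)$; $(x \vdash_{a'} y) \vdash_a z = x \vdash_{a \uparrow a'} (y \vdash_a z)$. For $a \in [\gamma]$, an element $e$ of $\mathcal{P}$ is an $a$-bar-unit if $x \dashv_a e = x = e \vdash_a x$ for all $x \in \mathcal{P}$, and an $a$-wire-unit if $e \dashv_a x = x = x \vdash_a e$ for all $x \in \mathcal{P}$. A wire-unit is an element that is an $a$-wire-unit for some $a \in [\gamma]$.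 -}

module Defs where

open import Algebra.Apartness.Bundles using (HeytingCommutativeRing; HeytingField)
open import Algebra.Bundles using (CommutativeRing)
import Algebra.Construct.NaturalChoice.Max as Max
open import Algebra.Core using (Op₂)
open import Algebra.Module.Bundles using (Module)
open import Algebra.Module.Morphism.Structures using (module ModuleMorphisms)
import Algebra.Definitions.RawMonoid as RawMonoidDefinitions
open import Data.Fin.Base using (Fin)
open import Data.Fin.Properties using (≤-totalOrder)
open import Data.Nat.Base using (ℕ; suc)
open import Data.Product.Base using (_×_; ∃-syntax)
open import Level using (Level; _⊔_) renaming (suc to lsuc)
open import Relation.Nullary.Negation.Core using (¬_)

private
  variable
    c ℓ₁ ℓ₂ r ℓr : Level

toCommutativeRing : HeytingField c ℓ₁ ℓ₂ → CommutativeRing c ℓ₁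
toCommutativeRing K =
  HeytingCommutativeRing.commutativeRing (HeytingField.heytingCommutativeRing K)

-- Requiring the apartness suc n · 1# # 0# instead would be constructively
-- stronger.
CharacteristicZero : HeytingField c ℓ₁ ℓ₂ → Set ℓ₁
CharacteristicZero K = ∀ n → ¬ (suc n · 1# ≈ 0#)
  where
  open CommutativeRing (toCommutativeRing K)
  open RawMonoidDefinitions +-rawMonoid using () renaming (_×_ to _·_)

module _ {R : CommutativeRing r ℓr} {m ℓm : Level} (M : Module R m ℓm) where
  open Module M
  open ModuleMorphisms rawModule rawModule

  IsBilinear : Op₂ Carrierᴹ → Set (r ⊔ m ⊔ ℓm)
  IsBilinear _∙_ =
      (∀ x → IsModuleHomomorphism (λ y → x ∙ y))
    × (∀ y → IsModuleHomomorphism (λ x → x ∙ y))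

-- The index set [γ] = {1, …, γ} is Fin γ (i ∈ [γ] being the element with
-- toℕ equal to i - 1); only its order matters. For b ∈ [γ], the subset [b]
-- is therefore { a | a ≤ b }, with b itself included.
infixl 7 _↑_
_↑_ : ∀ {γ} → Op₂ (Fin γ)
_↑_ {γ} = Max._⊔_ (≤-totalOrder γ)

record PluriassociativeAlgebra
         (K : HeytingField c ℓ₁ ℓ₂) (γ : ℕ) (m ℓm : Level)
         : Set (c ⊔ ℓ₁ ⊔ lsuc (m ⊔ ℓm)) where
  infix 7 _⊣[_]_ _⊢[_]_
  infix 4 _≐_

  field
    vectorSpace : Module (toCommutativeRing K) m ℓm

  open Module vectorSpace public

  field
    _⊣[_]_ : Carrierᴹ → Fin γ → Carrierᴹ → Carrierᴹ
    _⊢[_]_ : Carrierᴹ → Fin γ → Carrierᴹ → Carrierᴹ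

    ⊣-bilinear : ∀ a → IsBilinear vectorSpace (_⊣[ a ]_)
    ⊢-bilinear : ∀ a → IsBilinear vectorSpace (_⊢[ a ]_)

    ⊢-⊣-assoc : ∀ a a′ x y z →
      (x ⊢[ a′ ] y) ⊣[ a ] z ≈ᴹ x ⊢[ a′ ] (y ⊣[ a ] z)
    ⊣-⊣⊢-assoc : ∀ a a′ x y z →
      (x ⊣[ a ↑ a′ ] y) ⊣[ a ] z ≈ᴹ x ⊣[ a ] (y ⊢[ a′ ] z)
    ⊣⊢-⊢-assoc : ∀ a a′ x y z →
      (x ⊣[ a′ ] y) ⊢[ a ] z ≈ᴹ x ⊢[ a ] (y ⊢[ a ↑ a′ ] z)
    ⊣-⊣-assoc : ∀ a a′ x y z →
      (x ⊣[ a ] y) ⊣[ a ↑ a′ ] z ≈ᴹ x ⊣[ a ] (y ⊣[ a′ ] z)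
    ⊢-⊢-assoc : ∀ a a′ x y z →
      (x ⊢[ a′ ] y) ⊢[ a ] z ≈ᴹ x ⊢[ a ↑ a′ ] (y ⊢[ a ] z)

  _≐_ : Op₂ Carrierᴹ → Op₂ Carrierᴹ → Set (m ⊔ ℓm)
  f ≐ g = ∀ x y → f x y ≈ᴹ g x y

  IsBarUnit : Fin γ → Carrierᴹ → Set (m ⊔ ℓm)
  IsBarUnit a e = ∀ x → (x ⊣[ a ] e ≈ᴹ x) × (x ≈ᴹ e ⊢[ a ] x)

  IsWireUnitAt : Fin γ → Carrierᴹ → Set (m ⊔ ℓm)
  IsWireUnitAt a e = ∀ x → (e ⊣[ a ] x ≈ᴹ x) × (x ≈ᴹ x ⊢[ a ] e)

  IsWireUnit : Carrierᴹ → Set (m ⊔ ℓm)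
  IsWireUnit e = ∃[ a ] IsWireUnitAt a e

{-# OPTIONS --safe #-}
module Submission where

open import Defs
open import Algebra.Apartness.Bundles using (HeytingField)
import Algebra.Construct.NaturalChoice.Max as Max
open import Algebra.Module.Morphism.Structures using (module ModuleMorphisms)
open import Data.Fin.Base using (Fin; _≤_)
open import Data.Fin.Properties using (≤-totalOrder; ≤-refl; ≤-total)
open import Data.Nat.Base using (ℕ)
open import Data.Product.Base using (_×_; _,_; proj₁; proj₂)
open import Data.Sum.Base using (inj₁; inj₂)
open import Level using (Level)
open import Relation.Binary.PropositionalEquality.Core using (_≡_; subst)
import Relation.Binary.Reasoning.Setoid as ≈-Reasoning

-- Substituting the b-wire-unit e for an outer argument of an associativity
-- axiom erases one of its operations; the index b ↑ a = b that remains forces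
-- the operations of index a ≤ b to agree with those of index b. Uniqueness is
-- then the usual argument e = e ∙ f = f, once both units are brought down to
-- the smaller of their indices.

b↑a≡b : ∀ {γ} {a b : Fin γ} → a ≤ b → b ↑ a ≡ b
b↑a≡b {γ} = Max.x≤y⇒y⊔x≈y (≤-totalOrder γ)

module _ {c ℓ₁ ℓ₂ m ℓm : Level} {K : HeytingField c ℓ₁ ℓ₂} {γ : ℕ}
         (P : PluriassociativeAlgebra K γ m ℓm) where
  open PluriassociativeAlgebra P
  open ModuleMorphisms rawModule rawModule using (module IsModuleHomomorphism)
  open ≈-Reasoning ≈ᴹ-setoid

  ⊣-congʳ : ∀ a {x y} z → x ≈ᴹ y → x ⊣[ a ] z ≈ᴹ y ⊣[ a ] z
  ⊣-congʳ a z = IsModuleHomomorphism.⟦⟧-cong (proj₂ (⊣-bilinear a) z)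

  ⊢-congˡ : ∀ a x {y z} → y ≈ᴹ z → x ⊢[ a ] y ≈ᴹ x ⊢[ a ] z
  ⊢-congˡ a x = IsModuleHomomorphism.⟦⟧-cong (proj₁ (⊢-bilinear a) x)

  module WireUnit {b : Fin γ} {e : Carrierᴹ} (wire : IsWireUnitAt b e) where

    identityˡ : ∀ x → e ⊣[ b ] x ≈ᴹ x
    identityˡ x = proj₁ (wire x)

    identityʳ : ∀ x → x ⊢[ b ] e ≈ᴹ x
    identityʳ x = ≈ᴹ-sym (proj₂ (wire x))

    -- With `e` leftmost in `⊣-⊣-assoc`, the index `a` survives only on the right, under
    -- `e ⊣[ b ]_`, which is the identity; on the left it is absorbed into `b ↑ a`.
    ⊣-lower : ∀ {a} → a ≤ b → _⊣[ a ]_ ≐ _⊣[ b ]_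
    ⊣-lower {a} a≤b x y = begin
      x ⊣[ a ] y                 ≈⟨ identityˡ _ ⟨
      e ⊣[ b ] (x ⊣[ a ] y)      ≈⟨ subst (λ i → (e ⊣[ b ] x) ⊣[ i ] y ≈ᴹ _) (b↑a≡b a≤b) (⊣-⊣-assoc b a e x y) ⟨
      (e ⊣[ b ] x) ⊣[ b ] y      ≈⟨ ⊣-congʳ b y (identityˡ x) ⟩
      x ⊣[ b ] y                 ∎

    -- Mirror image of `⊣-lower`: `e` stands rightmost, where it is neutral for `⊢[ b ]`.
    ⊢-lower : ∀ {a} → a ≤ b → _⊢[ a ]_ ≐ _⊢[ b ]_
    ⊢-lower {a} a≤b x y = begin
      x ⊢[ a ] y                 ≈⟨ identityʳ _ ⟨
      (x ⊢[ a ] y) ⊢[ b ] e      ≈⟨ subst (λ i → _ ≈ᴹ x ⊢[ i ] (y ⊢[ b ] e)) (b↑a≡b a≤b) (⊢-⊢-assoc b a x y e) ⟩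
      x ⊢[ b ] (y ⊢[ b ] e)      ≈⟨ ⊢-congˡ b x (identityʳ y) ⟩
      x ⊢[ b ] y                 ∎

    -- `⊣-⊣⊢-assoc` trades a `⊣` for a `⊢`; with `e` leftmost and both indices equal to `b`, only
    -- these two products remain.
    ⊣≐⊢ : _⊣[ b ]_ ≐ _⊢[ b ]_
    ⊣≐⊢ x y = begin
      x ⊣[ b ] y                 ≈⟨ ⊣-congʳ b y (identityˡ x) ⟨
      (e ⊣[ b ] x) ⊣[ b ] y      ≈⟨ subst (λ i → (e ⊣[ i ] x) ⊣[ b ] y ≈ᴹ _) (b↑a≡b ≤-refl) (⊣-⊣⊢-assoc b b e x y) ⟩
      e ⊣[ b ] (x ⊢[ b ] y)      ≈⟨ identityˡ _ ⟩
      x ⊢[ b ] y                 ∎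

    lower : ∀ {a} → a ≤ b → IsWireUnitAt a e
    lower a≤b x =
        ≈ᴹ-trans (⊣-lower a≤b e x) (identityˡ x)
      , ≈ᴹ-sym (≈ᴹ-trans (⊢-lower a≤b x e) (identityʳ x))

    -- Both elements equal `e ⊣[ b ] f`: a wire-unit is neutral on the left of `⊣[ b ]`, a bar-unit
    -- on the right.
    barUnit-unique : ∀ {f} → IsBarUnit b f → f ≈ᴹ e
    barUnit-unique {f} bar = ≈ᴹ-trans (≈ᴹ-sym (identityˡ f)) (proj₁ (bar e))

    -- Wire-units are left-neutral for `⊣[ b ]` but right-neutral for `⊢[ b ]`, so `⊣≐⊢` has to link
    -- the two products of `e` and `f`.
    wireUnitAt-unique : ∀ {f} → IsWireUnitAt b f → f ≈ᴹ e
    wireUnitAt-unique {f} wire′ = begin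
      f                          ≈⟨ identityˡ f ⟨
      e ⊣[ b ] f                 ≈⟨ ⊣≐⊢ e f ⟩
      e ⊢[ b ] f                 ≈⟨ proj₂ (wire′ e) ⟨
      e                          ∎

  open WireUnit using (lower; wireUnitAt-unique)

  wireUnit-unique : ∀ {b e f} → IsWireUnitAt b e → IsWireUnit f → f ≈ᴹ e
  wireUnit-unique {b} wire (a , wire′) with ≤-total a b
  ... | inj₁ a≤b = wireUnitAt-unique (lower wire a≤b) wire′
  ... | inj₂ b≤a = wireUnitAt-unique wire (lower wire′ b≤a)

proposition3p2p1 : {c ℓ₁ ℓ₂ m ℓm : Level} (K : HeytingField c ℓ₁ ℓ₂) → CharacteristicZero K →
    (γ : ℕ) (P : PluriassociativeAlgebra K γ m ℓm) →
    let open PluriassociativeAlgebra P in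
    (b : Fin γ) (e : Carrierᴹ) → IsWireUnitAt b e →
    (∀ a → a ≤ b →
    (_⊣[ a ]_ ≐ _⊣[ b ]_) × (_⊣[ b ]_ ≐ _⊢[ a ]_) × (_⊢[ a ]_ ≐ _⊢[ b ]_))
    × (∀ a → a ≤ b → IsWireUnitAt a e)
    × (IsWireUnit e × (∀ f → IsWireUnit f → f ≈ᴹ e))
    × (∀ a → a ≤ b → ∀ e′ → IsBarUnit a e′ → e′ ≈ᴹ e)
proposition3p2p1 K _ γ P b e wire =
    (λ a a≤b →
        ⊣-lower a≤b
      , (λ x y → ≈ᴹ-trans (⊣≐⊢ x y) (≈ᴹ-sym (⊢-lower a≤b x y)))
      , ⊢-lower a≤b)
  , (λ a → lower)
  , ((b , wire) , λ f → wireUnit-unique P wire)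
  -- The comparison happens at the index `a` of the bar-unit, to which `e` is lowered.
  , (λ a a≤b e′ → WireUnit.barUnit-unique P (lower a≤b))
  where
  open PluriassociativeAlgebra P
  open WireUnit P wire
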